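{- There exist infinitely many positive integers $n$ such that for each such $n$ there is a graph $G$ with exactly $\binom{2n}{2}$ edges with the property that for every bipartition $V_1,V_2$ of $V(G)$, $\max\{e(V_1),e(V_2)\}\ge \binom{n}{2}+\frac{5n}{48}$.
   Context: For a bipartition $V_1,V_2$ of $V(G)$, $e(V_i)$ denotes the number of edges of $G$ with both ends in $V_i$. -}

module Defs where

open import Level using (0ℓ)
open import Data.Nat using (ℕ)
open import Data.Fin using (Fin; _<_)
open import Data.Fin.Properties using (_<?_)
open import Data.Fin.Subset using (Subset; _∈_; _∪_; _∩_; ⊤; ⊥)
open import Data.Fin.Subset.Properties using (_∈?_)
open import Data.List using (List; length; filter; allFin; cartesianProduct)
open import Data.Product using (_×_; _,_)
open import Relation.Binary using (Rel; Decidable; Symmetric)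
open import Relation.Binary.PropositionalEquality using (_≡_)
open import Relation.Nullary using (¬_)
open import Relation.Nullary.Decidable using (_×-dec_)

-- Finite simple graphs, with vertex set Fin order.
record Graph : Set₁ where
  field
    order  : ℕ
    _~_    : Rel (Fin order) 0ℓ
    _~?_   : Decidable _~_
    ~-sym  : Symmetric _~_
    ~-irr  : ∀ {v} → ¬ (v ~ v)

  Vertex : Set
  Vertex = Fin order

  -- Each unordered edge {u , v} is listed once, as the pair with u < v.
  edges : List (Vertex × Vertex)
  edges = filter (λ (u , v) → (u <? v) ×-dec (u ~? v))
                 (cartesianProduct (allFin order) (allFin order))

  edgeCount : ℕ
  edgeCount = length edges

  e : Subset order → ℕ
  e S = length (filter (λ (u , v) → (u ∈? S) ×-dec (v ∈? S)) edges)

-- Parts are allowed to be empty.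
record IsBipartition {N : ℕ} (V₁ V₂ : Subset N) : Set where
  field
    covers   : V₁ ∪ V₂ ≡ ⊤
    disjoint : V₁ ∩ V₂ ≡ ⊥

{-# OPTIONS --safe #-}

-- Put p = 2n − 1 and let k satisfy C(k,2) = p. The disjoint union of K_p and
-- K_k has C(p,2) + p = C(2n,2) edges. Some part contains at least n vertices
-- of K_p; if it contains n + 1 of them, it already has C(n,2) + n edges. If
-- the split of K_p is (n , n−1), the part with n of them gains the edges of
-- K_k inside it, while the other part starts n − 1 edges behind. About a
-- quarter of the vertices of K_k in the first part yields about n/8 extra
-- edges; with fewer, the second part receives three quarters of K_k, about
-- 9n/8 edges, which is again a surplus of about n/8. Since 1/8 > 5/48, all
-- large n of this form work; n = 4t² + 3t + 1 and k = 4t + 2 give such a family.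
module Submission where

open import Data.Nat using (ℕ; _<_; _*_; _⊔_)
open import Data.Nat.Combinatorics using (_C_)
open import Data.Integer using (+_)
open import Data.Rational using (_/_; _+_; _≥_)
open import Data.Fin.Subset using (Subset)
open import Data.Product using (Σ-syntax; ∃-syntax; _×_)
open import Relation.Binary.PropositionalEquality using (_≡_)
open import Defs

open import Data.Bool using (Bool; true; false; T; _∧_; not)
import Data.Bool.Properties as Bool
open import Data.Fin using (Fin; zero; suc)
import Data.Fin.Properties as Fin
open import Data.Fin.Subset using (⊤; _∪_; _∈_)
open import Data.Fin.Subset.Properties using (_∈?_; ∈⊤; x∈p∪q⁻)
import Data.Integer as ℤ
import Data.Integer.Properties as ℤ
open import Data.List using (length; filter; tabulate; map; _++_; cartesianProduct; []; _∷_; List)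
open import Data.List.Properties using (filter-++; filter-all; length-++; map-tabulate)
open import Data.List.Relation.Unary.All using (universal)
import Data.Nat as ℕ
open import Data.Nat using (zero; suc; z≤n; s≤s)
open import Data.Nat.Combinatorics using (nCk+nC[k+1]≡[n+1]C[k+1]; nC1≡n)
import Data.Nat.Properties as ℕ
open import Data.Nat.Tactic.RingSolver using (solve-∀)
open import Data.Product using (_,_)
import Data.Rational as ℚ
import Data.Rational.Properties as ℚ
import Data.Rational.Unnormalised as ℚᵘ
import Data.Rational.Unnormalised.Properties as ℚᵘ
open import Data.Sum using (inj₁; inj₂)
open import Function using (_∘_; id)
open import Level using (Level)
open import Relation.Binary.PropositionalEquality using (_≢_; refl; sym; trans; cong; cong₂; subst; subst₂; module ≡-Reasoning)
open import Relation.Nullary using (does; yes; no)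
open import Relation.Nullary.Decidable using (_×-dec_; ¬?; dec-true)
open import Relation.Unary using (Pred; Decidable)

open import Algebra.Properties.CommutativeMonoid.Sum ℕ.+-0-commutativeMonoid
  using (sum; sum-cong-≗; sum-replicate-zero; ∑-distrib-+)

private variable
  a ℓ₁ ℓ₂ : Level
  A B : Set a
  M N : ℕ

-- Indicator sums and lengths of filtered lists.

⟦_⟧ : Bool → ℕ
⟦ true ⟧  = 1
⟦ false ⟧ = 0

count : (Fin N → Bool) → ℕ
count x = sum (λ i → ⟦ x i ⟧)

sum-mono : ∀ {f g : Fin N → ℕ} → (∀ i → f i ℕ.≤ g i) → sum f ℕ.≤ sum g
sum-mono {zero}  f≤g = z≤n
sum-mono {suc N} f≤g = ℕ.+-mono-≤ (f≤g zero) (sum-mono (f≤g ∘ suc))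

length-filter-tabulate : {P : Pred A ℓ₁} (P? : Decidable P) (f : Fin N → A) →
  length (filter P? (tabulate f)) ≡ count (λ i → does (P? (f i)))
length-filter-tabulate {N = zero}  P? f = refl
length-filter-tabulate {N = suc N} P? f with does (P? (f zero))
... | true  = cong suc (length-filter-tabulate P? (f ∘ suc))
... | false = length-filter-tabulate P? (f ∘ suc)

-- Turns edge counts, which are lengths of filtered lists of pairs, into double sums of indicators
-- that can be manipulated pointwise.
length-filter-cartesianProduct : {P : Pred (A × B) ℓ₁} (P? : Decidable P)
  (f : Fin M → A) (g : Fin N → B) →
  length (filter P? (cartesianProduct (tabulate f) (tabulate g))) ≡
  sum (λ i → count (λ j → does (P? (f i , g j))))
length-filter-cartesianProduct {M = zero}  P? f g = refl
length-filter-cartesianProduct {M = suc M} P? f g = begin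
  length (filter P? (map (f zero ,_) (tabulate g) ++ rest))
    ≡⟨ cong length (filter-++ P? (map (f zero ,_) (tabulate g)) rest) ⟩
  length (filter P? (map (f zero ,_) (tabulate g)) ++ filter P? rest)
    ≡⟨ length-++ (filter P? (map (f zero ,_) (tabulate g))) ⟩
  length (filter P? (map (f zero ,_) (tabulate g))) ℕ.+ length (filter P? rest)
    ≡⟨ cong₂ ℕ._+_
         (trans (cong (length ∘ filter P?) (map-tabulate g (f zero ,_)))
                (length-filter-tabulate P? ((f zero ,_) ∘ g)))
         (length-filter-cartesianProduct P? (f ∘ suc) g) ⟩
  sum (λ i → count (λ j → does (P? (f i , g j)))) ∎
  where
  open ≡-Reasoning
  rest = cartesianProduct (tabulate (f ∘ suc)) (tabulate g)

filter-filter : {P : Pred A ℓ₁} {Q : Pred A ℓ₂} (P? : Decidable P) (Q? : Decidable Q) (xs : List A) →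
  filter Q? (filter P? xs) ≡ filter (λ x → P? x ×-dec Q? x) xs
filter-filter P? Q? []       = refl
filter-filter P? Q? (x ∷ xs) with does (P? x)
... | false = filter-filter P? Q? xs
... | true  with does (Q? x)
...   | true  = cong (x ∷_) (filter-filter P? Q? xs)
...   | false = filter-filter P? Q? xs

-- Binomial coefficients with lower index 2.

suc-C-2 : ∀ n → suc n C 2 ≡ n ℕ.+ n C 2
suc-C-2 n = trans (sym (nCk+nC[k+1]≡[n+1]C[k+1] n 1)) (cong (ℕ._+ n C 2) (nC1≡n n))

double-C-2 : ∀ n → 2 * (suc n C 2) ≡ suc n * n
double-C-2 zero    = refl
double-C-2 (suc n) = begin
  2 * (suc (suc n) C 2)         ≡⟨ cong (2 *_) (suc-C-2 (suc n)) ⟩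
  2 * (suc n ℕ.+ suc n C 2)     ≡⟨ ℕ.*-distribˡ-+ 2 (suc n) (suc n C 2) ⟩
  2 * suc n ℕ.+ 2 * (suc n C 2) ≡⟨ cong (2 * suc n ℕ.+_) (double-C-2 n) ⟩
  2 * suc n ℕ.+ suc n * n       ≡⟨ lemma n ⟩
  suc (suc n) * suc n           ∎
  where
  open ≡-Reasoning
  lemma : ∀ n → 2 * suc n ℕ.+ suc n * n ≡ suc (suc n) * suc n
  lemma = solve-∀

C-2-mono-≤ : ∀ {m n} → m ℕ.≤ n → m C 2 ℕ.≤ n C 2
C-2-mono-≤ z≤n = z≤n
C-2-mono-≤ {suc m} {suc n} (s≤s m≤n) =
  subst₂ ℕ._≤_ (sym (suc-C-2 m)) (sym (suc-C-2 n)) (ℕ.+-mono-≤ m≤n (C-2-mono-≤ m≤n))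

-- By induction on `N`: vertex `zero` lies below every other vertex, so if `x` selects it, its row
-- contributes `count (x ∘ suc)`, which is Pascal's rule; otherwise its row vanishes.
count-increasing-pairs : ∀ (x : Fin N → Bool) →
  sum (λ u → count (λ v → does (u Fin.<? v) ∧ (x u ∧ x v))) ≡ count x C 2
count-increasing-pairs {zero}  x = refl
count-increasing-pairs {suc N} x with x zero
... | true  = trans (cong (count (x ∘ suc) ℕ.+_) (count-increasing-pairs (x ∘ suc)))
                    (sym (suc-C-2 (count (x ∘ suc))))
... | false = cong₂ ℕ._+_ (sum-replicate-zero N) (count-increasing-pairs (x ∘ suc))

-- Disjoint union of two cliques, realised as the colour classes of `c`.

cliquePair : (Fin N → Bool) → Graph
cliquePair {N} c = record
  { order = N
  ; _~_   = λ u v → u ≢ v × c u ≡ c v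
  ; _~?_  = λ u v → ¬? (u Fin.≟ v) ×-dec (c u Bool.≟ c v)
  ; ~-sym = λ (u≢v , cu≡cv) → u≢v ∘ sym , sym cu≡cv
  ; ~-irr = λ (u≢u , _) → u≢u refl
  }

-- Here `l` stands for `u < v` and `d` for `u ≢ v`, so the implication lets the order test absorb
-- the distinctness test. What remains is a case check: equal colours put the pair in exactly one
-- class, different colours in none.
⟦⟧-two-classes : ∀ l d cu cv su sv → (l ≡ true → d ≡ true) →
  ⟦ (l ∧ (d ∧ does (cu Bool.≟ cv))) ∧ (su ∧ sv) ⟧ ≡
  ⟦ l ∧ ((cu ∧ su) ∧ (cv ∧ sv)) ⟧ ℕ.+ ⟦ l ∧ ((not cu ∧ su) ∧ (not cv ∧ sv)) ⟧
⟦⟧-two-classes false _ _     _     _     _ _ = refl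
⟦⟧-two-classes true  d cu cv su sv l⇒d with d | l⇒d refl
⟦⟧-two-classes true  d true  true  su    sv _ | _ | refl = sym (ℕ.+-identityʳ _)
⟦⟧-two-classes true  d true  false true  sv _ | _ | refl = refl
⟦⟧-two-classes true  d true  false false sv _ | _ | refl = refl
⟦⟧-two-classes true  d false true  true  sv _ | _ | refl = refl
⟦⟧-two-classes true  d false true  false sv _ | _ | refl = refl
⟦⟧-two-classes true  d false false su    sv _ | _ | refl = refl

module _ (c : Fin N → Bool) where
  open Graph (cliquePair c) using (e; edges; edgeCount; _~?_)

  inFirst inSecond : Subset N → Fin N → Bool
  inFirst  S u = c u ∧ does (u ∈? S)
  inSecond S u = not (c u) ∧ does (u ∈? S)

  -- No edge joins the two classes, and inside a class every increasing pair is an edge, so each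
  -- class contributes all pairs of its vertices in `S`.
  e-cliquePair : ∀ S → e S ≡ count (inFirst S) C 2 ℕ.+ count (inSecond S) C 2
  e-cliquePair S = begin
    e S
      ≡⟨ cong length (filter-filter edge? within? (cartesianProduct (tabulate id) (tabulate id))) ⟩
    length (filter (λ uv → edge? uv ×-dec within? uv) (cartesianProduct (tabulate id) (tabulate id)))
      ≡⟨ length-filter-cartesianProduct (λ uv → edge? uv ×-dec within? uv) id id ⟩
    sum (λ u → count (λ v → does (edge? (u , v) ×-dec within? (u , v))))
      ≡⟨ sum-cong-≗ (λ u → trans (sum-cong-≗ (pointwise u))
                                 (∑-distrib-+ (⟦_⟧ ∘ pairIn (inFirst S) u) (⟦_⟧ ∘ pairIn (inSecond S) u))) ⟩
    sum (λ u → count (pairIn (inFirst S) u) ℕ.+ count (pairIn (inSecond S) u))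
      ≡⟨ ∑-distrib-+ (count ∘ pairIn (inFirst S)) (count ∘ pairIn (inSecond S)) ⟩
    sum (count ∘ pairIn (inFirst S)) ℕ.+ sum (count ∘ pairIn (inSecond S))
      ≡⟨ cong₂ ℕ._+_ (count-increasing-pairs (inFirst S)) (count-increasing-pairs (inSecond S)) ⟩
    count (inFirst S) C 2 ℕ.+ count (inSecond S) C 2 ∎
    where
    open ≡-Reasoning
    edge?   = λ ((u , v) : Fin N × Fin N) → (u Fin.<? v) ×-dec (u ~? v)
    within? = λ ((u , v) : Fin N × Fin N) → (u ∈? S) ×-dec (v ∈? S)

    pairIn : (Fin N → Bool) → Fin N → Fin N → Bool
    pairIn x u v = does (u Fin.<? v) ∧ (x u ∧ x v)

    <⇒≢ : ∀ u v → does (u Fin.<? v) ≡ true → not (does (u Fin.≟ v)) ≡ true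
    <⇒≢ u v eq = dec-true (¬? (u Fin.≟ v)) (Fin.<⇒≢ (ℕ.<ᵇ⇒< _ _ (subst T (sym eq) _)))

    pointwise : ∀ u v → ⟦ does (edge? (u , v) ×-dec within? (u , v)) ⟧ ≡
                        ⟦ pairIn (inFirst S) u v ⟧ ℕ.+ ⟦ pairIn (inSecond S) u v ⟧
    pointwise u v = ⟦⟧-two-classes (does (u Fin.<? v)) (not (does (u Fin.≟ v))) (c u) (c v)
      (does (u ∈? S)) (does (v ∈? S)) (<⇒≢ u v)

  edgeCount-cliquePair : edgeCount ≡ count c C 2 ℕ.+ count (not ∘ c) C 2
  edgeCount-cliquePair = begin
    edgeCount
      -- Every edge lies inside `⊤`, so the total is the case `S = ⊤` of the formula above.
      ≡⟨ cong length (sym (filter-all (λ (u , v) → (u ∈? ⊤) ×-dec (v ∈? ⊤)) (universal (λ _ → ∈⊤ , ∈⊤) edges))) ⟩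
    e ⊤
      ≡⟨ e-cliquePair ⊤ ⟩
    count (inFirst ⊤) C 2 ℕ.+ count (inSecond ⊤) C 2
      ≡⟨ cong₂ (λ x y → x C 2 ℕ.+ y C 2) (sum-cong-≗ (cong ⟦_⟧ ∘ restrict c))
                                         (sum-cong-≗ (cong ⟦_⟧ ∘ restrict (not ∘ c))) ⟩
    count c C 2 ℕ.+ count (not ∘ c) C 2 ∎
    where
    open ≡-Reasoning
    restrict : ∀ (x : Fin N → Bool) u → x u ∧ does (u ∈? ⊤) ≡ x u
    restrict x u = trans (cong (x u ∧_) (dec-true (u ∈? ⊤) ∈⊤)) (Bool.∧-identityʳ (x u))

-- Vertex counts of the parts and of the colour classes.

count-cover : ∀ (x : Fin N → Bool) {V₁ V₂ : Subset N} → V₁ ∪ V₂ ≡ ⊤ →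
  count x ℕ.≤ count (λ u → x u ∧ does (u ∈? V₁)) ℕ.+ count (λ u → x u ∧ does (u ∈? V₂))
count-cover x {V₁} {V₂} cov =
  subst (count x ℕ.≤_) (∑-distrib-+ (λ u → ⟦ x u ∧ does (u ∈? V₁) ⟧) (λ u → ⟦ x u ∧ does (u ∈? V₂) ⟧))
        (sum-mono pointwise)
  where
  pointwise : ∀ u → ⟦ x u ⟧ ℕ.≤ ⟦ x u ∧ does (u ∈? V₁) ⟧ ℕ.+ ⟦ x u ∧ does (u ∈? V₂) ⟧
  pointwise u with x u | x∈p∪q⁻ V₁ V₂ (subst (u ∈_) (sym cov) ∈⊤)
  ... | false | _         = z≤n
  ... | true  | inj₁ u∈V₁ rewrite dec-true (u ∈? V₁) u∈V₁ = s≤s z≤n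
  ... | true  | inj₂ u∈V₂ rewrite dec-true (u ∈? V₂) u∈V₂ = ℕ.m≤n+m 1 _

initialSegment : ∀ p {k} → Fin (p ℕ.+ k) → Bool
initialSegment zero    _       = false
initialSegment (suc p) zero    = true
initialSegment (suc p) (suc i) = initialSegment p i

count-initialSegment : ∀ p k → count (initialSegment p {k}) ≡ p
count-initialSegment zero    k = sum-replicate-zero k
count-initialSegment (suc p) k = cong suc (count-initialSegment p k)

count-true : ∀ k → count {k} (λ _ → true) ≡ k
count-true zero    = refl
count-true (suc k) = cong suc (count-true k)

count-not-initialSegment : ∀ p k → count (not ∘ initialSegment p {k}) ≡ k
count-not-initialSegment zero    k = count-true k
count-not-initialSegment (suc p) k = count-not-initialSegment p k

-- Arithmetic of the family.

-- n − 1 as a function of t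
base : ℕ → ℕ
base t = 4 * t * t ℕ.+ 3 * t

-- This is the condition `k C 2 ≡ p` for `k = 4t + 2` and `p = 2n − 1`.
4t+2-C-2 : ∀ t → (4 * t ℕ.+ 2) C 2 ≡ suc (2 * base t)
4t+2-C-2 t = ℕ.*-cancelˡ-≡ _ _ 2 (begin
  2 * ((4 * t ℕ.+ 2) C 2)           ≡⟨ cong (λ k → 2 * (k C 2)) (eq₁ t) ⟩
  2 * (suc (4 * t ℕ.+ 1) C 2)       ≡⟨ double-C-2 (4 * t ℕ.+ 1) ⟩
  suc (4 * t ℕ.+ 1) * (4 * t ℕ.+ 1) ≡⟨ eq₂ t ⟩
  2 * suc (2 * base t)              ∎)
  where
  open ≡-Reasoning
  eq₁ : ∀ t → 4 * t ℕ.+ 2 ≡ suc (4 * t ℕ.+ 1)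
  eq₁ = solve-∀
  eq₂ : ∀ t → suc (4 * t ℕ.+ 1) * (4 * t ℕ.+ 1) ≡ 2 * suc (2 * (4 * t * t ℕ.+ 3 * t))
  eq₂ = solve-∀

-- The factor 48 clears the denominator of 5n/48 and makes the binomial a polynomial for the ring
-- solver.
48*C-2 : ∀ n → 48 * (suc n C 2) ≡ 24 * (suc n * n)
48*C-2 n = trans (ℕ.*-assoc 24 2 (suc n C 2)) (cong (24 *_) (double-C-2 n))

-- The slack 1/8 − 5/48 beats the linear error terms from t = 10 on.
quarter-bound : ∀ s → 5 * suc (base (10 ℕ.+ s)) ℕ.≤ 48 * ((10 ℕ.+ s) C 2)
quarter-bound s = subst (5 * suc (base (10 ℕ.+ s)) ℕ.≤_) (sym (trans (48*C-2 (9 ℕ.+ s)) (eq s))) (ℕ.m≤m+n _ _)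
  where
  eq : ∀ s → 24 * ((10 ℕ.+ s) * (9 ℕ.+ s)) ≡
             5 * suc (4 * (10 ℕ.+ s) * (10 ℕ.+ s) ℕ.+ 3 * (10 ℕ.+ s)) ℕ.+ (4 * (s * s) ℕ.+ 41 * s ℕ.+ 5)
  eq = solve-∀

-- Serves the part with only `n − 1` vertices of the large clique: its `3 + 3t` vertices of the
-- small one must repay the `n − 1` missing edges and still yield 5n/48. The difference of the two
-- sides has only nonnegative coefficients in `t`.
three-quarters-bound : ∀ t → 48 * base t ℕ.+ 5 * suc (base t) ℕ.≤ 48 * ((3 ℕ.+ 3 * t) C 2)
three-quarters-bound t = subst (48 * base t ℕ.+ 5 * suc (base t) ℕ.≤_)
  (sym (trans (48*C-2 (2 ℕ.+ 3 * t)) (eq t))) (ℕ.m≤m+n _ _)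
  where
  eq : ∀ t → 24 * ((3 ℕ.+ 3 * t) * (2 ℕ.+ 3 * t)) ≡
             (48 * (4 * t * t ℕ.+ 3 * t) ℕ.+ 5 * suc (4 * t * t ℕ.+ 3 * t)) ℕ.+ (4 * (t * t) ℕ.+ 201 * t ℕ.+ 139)
  eq = solve-∀

-- From natural numbers to the rational bound.

/1-≥-/1+/48 : ∀ x y z → 48 * y ℕ.+ z ℕ.≤ 48 * x → (+ x) / 1 ≥ (+ y) / 1 + (+ z) / 48
/1-≥-/1+/48 x y z h = ℚ.toℚᵘ-cancel-≤ (begin
  ℚ.toℚᵘ ((+ y) / 1 + (+ z) / 48)
    ≃⟨ ℚ.toℚᵘ-homo-+ ((+ y) / 1) ((+ z) / 48) ⟩
  ℚ.toℚᵘ ((+ y) / 1) ℚᵘ.+ ℚ.toℚᵘ ((+ z) / 48)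
    -- `mkℚᵘ` stores the denominator minus one, so 0 and 47 encode denominators 1 and 48.
    ≃⟨ ℚᵘ.+-cong (ℚ.toℚᵘ-fromℚᵘ (ℚᵘ.mkℚᵘ (+ y) 0)) (ℚ.toℚᵘ-fromℚᵘ (ℚᵘ.mkℚᵘ (+ z) 47)) ⟩
  ℚᵘ.mkℚᵘ (+ y) 0 ℚᵘ.+ ℚᵘ.mkℚᵘ (+ z) 47
    ≤⟨ ℚᵘ.*≤* (subst₂ ℤ._≤_ (lhs y z) (trans (cong +_ (ℕ.*-comm 48 x)) (ℤ.pos-* x 48)) (ℤ.+≤+ h)) ⟩
  ℚᵘ.mkℚᵘ (+ x) 0
    ≃⟨ ℚ.toℚᵘ-fromℚᵘ (ℚᵘ.mkℚᵘ (+ x) 0) ⟨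
  ℚ.toℚᵘ ((+ x) / 1) ∎)
  where
  open ℚᵘ.≤-Reasoning
  lhs : ∀ y z → + (48 * y ℕ.+ z) ≡ ((+ y) ℤ.* (+ 48) ℤ.+ (+ z) ℤ.* (+ 1)) ℤ.* (+ 1)
  lhs y z = sym (trans (ℤ.*-identityʳ _) (cong₂ ℤ._+_
    (trans (sym (ℤ.pos-* y 48)) (cong +_ (ℕ.*-comm y 48))) (ℤ.*-identityʳ (+ z))))

module _ (n p k : ℕ) where
  private
    c : Fin (p ℕ.+ k) → Bool
    c = initialSegment p

    G : Graph
    G = cliquePair c

  -- Reduces the graph statement to arithmetic: `aᵢ` and `bᵢ` are the numbers of vertices of the
  -- first and second clique in `Vᵢ`.
  disjointCliques-judicious : p C 2 ℕ.+ k C 2 ≡ (2 * n) C 2 →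
    (∀ a₁ a₂ b₁ b₂ → p ℕ.≤ a₁ ℕ.+ a₂ → k ℕ.≤ b₁ ℕ.+ b₂ →
      48 * (n C 2) ℕ.+ 5 * n ℕ.≤ 48 * ((a₁ C 2 ℕ.+ b₁ C 2) ⊔ (a₂ C 2 ℕ.+ b₂ C 2))) →
    Σ[ G ∈ Graph ]
      (Graph.edgeCount G ≡ (2 * n) C 2 ×
      (∀ (V₁ V₂ : Subset (Graph.order G)) → IsBipartition V₁ V₂ →
      (+ (Graph.e G V₁ ⊔ Graph.e G V₂)) / 1 ≥ (+ (n C 2)) / 1 + (+ (5 * n)) / 48))
  disjointCliques-judicious edges≡ bound = G , edge-count , judicious
    where
    edge-count : Graph.edgeCount G ≡ (2 * n) C 2
    edge-count = trans (edgeCount-cliquePair c) (trans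
      (cong₂ (λ x y → x C 2 ℕ.+ y C 2) (count-initialSegment p k) (count-not-initialSegment p k))
      edges≡)

    judicious : (V₁ V₂ : Subset (p ℕ.+ k)) → IsBipartition V₁ V₂ →
      (+ (Graph.e G V₁ ⊔ Graph.e G V₂)) / 1 ≥ (+ (n C 2)) / 1 + (+ (5 * n)) / 48
    judicious V₁ V₂ bip = /1-≥-/1+/48 (Graph.e G V₁ ⊔ Graph.e G V₂) (n C 2) (5 * n)
      (subst (λ m → 48 * (n C 2) ℕ.+ 5 * n ℕ.≤ 48 * m)
        (sym (cong₂ _⊔_ (e-cliquePair c V₁) (e-cliquePair c V₂)))
        (bound (count (inFirst c V₁)) (count (inFirst c V₂)) (count (inSecond c V₁)) (count (inSecond c V₂))
          (subst (ℕ._≤ count (inFirst c V₁) ℕ.+ count (inFirst c V₂))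
            (count-initialSegment p k) (count-cover c {V₁} {V₂} covers))
          (subst (ℕ._≤ count (inSecond c V₁) ℕ.+ count (inSecond c V₂))
            (count-not-initialSegment p k) (count-cover (not ∘ c) {V₁} {V₂} covers))))
      where open IsBipartition bip

-- The family and its case analysis.

module _ (s : ℕ) where
  -- Writing `t` as `10 + s` builds in the threshold `t ≥ 10` of `quarter-bound`.
  t n-1 n p k : ℕ
  t   = 10 ℕ.+ s
  n-1 = base t
  n   = suc n-1
  p   = suc (2 * n-1)
  k   = 4 * t ℕ.+ 2

  majority-bound : ∀ a₁ a₂ b₁ b₂ → n ℕ.≤ a₁ → p ℕ.≤ a₁ ℕ.+ a₂ → k ℕ.≤ b₁ ℕ.+ b₂ →
    48 * (n C 2) ℕ.+ 5 * n ℕ.≤ 48 * ((a₁ C 2 ℕ.+ b₁ C 2) ⊔ (a₂ C 2 ℕ.+ b₂ C 2))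
  majority-bound a₁ a₂ b₁ b₂ n≤a₁ p≤a k≤b with n ℕ.<? a₁ | t ℕ.≤? b₁
  -- One vertex beyond `n` adds `n` edges, more than the required 5n/48.
  ... | yes n<a₁ | _ = begin
    48 * (n C 2) ℕ.+ 5 * n  ≤⟨ ℕ.+-monoʳ-≤ (48 * (n C 2)) (ℕ.*-monoˡ-≤ n {5} {48} (ℕ.m≤m+n 5 43)) ⟩
    48 * (n C 2) ℕ.+ 48 * n ≡⟨ ℕ.+-comm (48 * (n C 2)) (48 * n) ⟩
    48 * n ℕ.+ 48 * (n C 2) ≡⟨ ℕ.*-distribˡ-+ 48 n (n C 2) ⟨
    48 * (n ℕ.+ n C 2)      ≡⟨ cong (48 *_) (suc-C-2 n) ⟨
    48 * (suc n C 2)        ≤⟨ ℕ.*-monoʳ-≤ 48 (ℕ.≤-trans (C-2-mono-≤ n<a₁)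
                                 (ℕ.≤-trans (ℕ.m≤m+n (a₁ C 2) (b₁ C 2)) (ℕ.m≤m⊔n _ _))) ⟩
    48 * ((a₁ C 2 ℕ.+ b₁ C 2) ⊔ (a₂ C 2 ℕ.+ b₂ C 2)) ∎
    where open ℕ.≤-Reasoning
  -- The surplus comes from the `t` vertices of the second clique lying in the first part.
  ... | no _ | yes t≤b₁ = begin
    48 * (n C 2) ℕ.+ 5 * n        ≤⟨ ℕ.+-monoʳ-≤ (48 * (n C 2)) (quarter-bound s) ⟩
    48 * (n C 2) ℕ.+ 48 * (t C 2) ≡⟨ ℕ.*-distribˡ-+ 48 (n C 2) (t C 2) ⟨
    48 * (n C 2 ℕ.+ t C 2)        ≤⟨ ℕ.*-monoʳ-≤ 48 (ℕ.≤-trans (ℕ.+-mono-≤ (C-2-mono-≤ n≤a₁) (C-2-mono-≤ t≤b₁))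
                                       (ℕ.m≤m⊔n _ _)) ⟩
    48 * ((a₁ C 2 ℕ.+ b₁ C 2) ⊔ (a₂ C 2 ℕ.+ b₂ C 2)) ∎
    where open ℕ.≤-Reasoning
  -- Now `a₁ ≤ n` leaves at least `n − 1` vertices of the first clique to the second part, and
  -- `b₁ ≤ t − 1` leaves it at least `(4t + 2) − (t − 1) = 3t + 3` of the second.
  ... | no n≮a₁ | no t≰b₁ = begin
    48 * (n C 2) ℕ.+ 5 * n                         ≡⟨ cong (λ m → 48 * m ℕ.+ 5 * n) (suc-C-2 n-1) ⟩
    48 * (n-1 ℕ.+ n-1 C 2) ℕ.+ 5 * n               ≡⟨ regroup n-1 (n-1 C 2) (5 * n) ⟩
    48 * (n-1 C 2) ℕ.+ (48 * n-1 ℕ.+ 5 * n)        ≤⟨ ℕ.+-monoʳ-≤ (48 * (n-1 C 2)) (three-quarters-bound t) ⟩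
    48 * (n-1 C 2) ℕ.+ 48 * ((3 ℕ.+ 3 * t) C 2)    ≡⟨ ℕ.*-distribˡ-+ 48 (n-1 C 2) ((3 ℕ.+ 3 * t) C 2) ⟨
    48 * (n-1 C 2 ℕ.+ (3 ℕ.+ 3 * t) C 2)           ≤⟨ ℕ.*-monoʳ-≤ 48 (ℕ.≤-trans
                                                        (ℕ.+-mono-≤ (C-2-mono-≤ n-1≤a₂) (C-2-mono-≤ 3+3t≤b₂))
                                                        (ℕ.m≤n⊔m (a₁ C 2 ℕ.+ b₁ C 2) _)) ⟩
    48 * ((a₁ C 2 ℕ.+ b₁ C 2) ⊔ (a₂ C 2 ℕ.+ b₂ C 2)) ∎
    where
    open ℕ.≤-Reasoning
    regroup : ∀ x y z → 48 * (x ℕ.+ y) ℕ.+ z ≡ 48 * y ℕ.+ (48 * x ℕ.+ z)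
    regroup = solve-∀

    n-1≤a₂ : n-1 ℕ.≤ a₂
    n-1≤a₂ = ℕ.+-cancelˡ-≤ n n-1 a₂ (begin
      n ℕ.+ n-1     ≡⟨ double n-1 ⟩
      suc (2 * n-1) ≤⟨ p≤a ⟩
      a₁ ℕ.+ a₂     ≤⟨ ℕ.+-monoˡ-≤ a₂ (ℕ.≮⇒≥ n≮a₁) ⟩
      n ℕ.+ a₂      ∎)
      where
      double : ∀ m → suc m ℕ.+ m ≡ suc (2 * m)
      double = solve-∀

    3+3t≤b₂ : 3 ℕ.+ 3 * t ℕ.≤ b₂
    3+3t≤b₂ = ℕ.+-cancelˡ-≤ t (3 ℕ.+ 3 * t) b₂ (begin
      t ℕ.+ (3 ℕ.+ 3 * t) ≡⟨ quadruple t ⟩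
      suc (4 * t ℕ.+ 2)   ≤⟨ s≤s k≤b ⟩
      suc b₁ ℕ.+ b₂       ≤⟨ ℕ.+-monoˡ-≤ b₂ (ℕ.≰⇒> t≰b₁) ⟩
      t ℕ.+ b₂            ∎)
      where
      quadruple : ∀ t → t ℕ.+ (3 ℕ.+ 3 * t) ≡ suc (4 * t ℕ.+ 2)
      quadruple = solve-∀

  -- Pigeonhole on `p = 2(n − 1) + 1`: one part gets `n` vertices of the first clique, and the parts
  -- are swapped if it is the second.
  split-bound : ∀ a₁ a₂ b₁ b₂ → p ℕ.≤ a₁ ℕ.+ a₂ → k ℕ.≤ b₁ ℕ.+ b₂ →
    48 * (n C 2) ℕ.+ 5 * n ℕ.≤ 48 * ((a₁ C 2 ℕ.+ b₁ C 2) ⊔ (a₂ C 2 ℕ.+ b₂ C 2))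
  split-bound a₁ a₂ b₁ b₂ p≤a k≤b with n ℕ.≤? a₁
  ... | yes n≤a₁ = majority-bound a₁ a₂ b₁ b₂ n≤a₁ p≤a k≤b
  ... | no  n≰a₁ = subst (λ m → 48 * (n C 2) ℕ.+ 5 * n ℕ.≤ 48 * m)
    (ℕ.⊔-comm (a₂ C 2 ℕ.+ b₂ C 2) (a₁ C 2 ℕ.+ b₁ C 2))
    (majority-bound a₂ a₁ b₂ b₁ n≤a₂
      (subst (p ℕ.≤_) (ℕ.+-comm a₁ a₂) p≤a)
      (subst (k ℕ.≤_) (ℕ.+-comm b₁ b₂) k≤b))
    where
    open ℕ.≤-Reasoning
    n≤a₂ : n ℕ.≤ a₂
    n≤a₂ = ℕ.+-cancelˡ-≤ n-1 n a₂ (begin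
      n-1 ℕ.+ n     ≡⟨ double n-1 ⟩
      suc (2 * n-1) ≤⟨ p≤a ⟩
      a₁ ℕ.+ a₂     ≤⟨ ℕ.+-monoˡ-≤ a₂ (ℕ.≤-pred (ℕ.≰⇒> n≰a₁)) ⟩
      n-1 ℕ.+ a₂    ∎)
      where
      double : ∀ m → m ℕ.+ suc m ≡ suc (2 * m)
      double = solve-∀

  -- Since `k C 2` equals `p`, the small clique adds as many edges as joining one new vertex to all
  -- of the large clique, giving `suc p C 2` with `suc p = 2n`.
  edges≡ : p C 2 ℕ.+ k C 2 ≡ (2 * n) C 2
  edges≡ = begin
    p C 2 ℕ.+ k C 2 ≡⟨ cong (p C 2 ℕ.+_) (4t+2-C-2 t) ⟩
    p C 2 ℕ.+ p     ≡⟨ ℕ.+-comm (p C 2) p ⟩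
    p ℕ.+ p C 2     ≡⟨ suc-C-2 p ⟨
    suc p C 2       ≡⟨ cong (_C 2) (ℕ.*-suc 2 n-1) ⟨
    (2 * n) C 2     ∎
    where open ≡-Reasoning

  -- Makes the family unbounded: the member with `s = N` exceeds any given `N`.
  s<n : s < n
  s<n = s≤s (begin
    s     ≤⟨ ℕ.m≤n+m s 10 ⟩
    t     ≤⟨ ℕ.m≤n*m t 3 ⟩
    3 * t ≤⟨ ℕ.m≤n+m (3 * t) (4 * t * t) ⟩
    n-1   ∎)
    where open ℕ.≤-Reasoning

theorem1p4 : ∀ (N : ℕ) → ∃[ n ] (N < n ×
    (Σ[ G ∈ Graph ]
    (Graph.edgeCount G ≡ (2 * n) C 2 ×
    (∀ (V₁ V₂ : Subset (Graph.order G)) → IsBipartition V₁ V₂ →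
    (+ (Graph.e G V₁ ⊔ Graph.e G V₂)) / 1 ≥ (+ (n C 2)) / 1 + (+ (5 * n)) / 48))))
theorem1p4 N = n N , s<n N , disjointCliques-judicious (n N) (p N) (k N) (edges≡ N) (split-bound N)
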